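{- Assuming Markov's principle, the following are equivalent: (1) the limited principle of omniscience $\mathsf{LPO}$; (2) $\mathbb{N} + \mathbb{N}_\infty$ has the $\neg\neg$ strong Myhill property.
   Context: The statement is to be proved constructively (intuitionistic set theory with powersets and $\mathbb{N}$, equivalently the internal logic of a topos with natural numbers object; neither excluded middle nor choice is assumed). $\mathbb{N}_\infty \subseteq 2^{\mathbb{N}}$ is the set of bit sequences containing at most one $1$; $+$ is disjoint union. Markov's principle: for every $p \in 2^{\mathbb{N}}$, if $p \neq 0^\omega$ (the constant $0$ sequence), then there exists $n$ with $p_n = 1$. $\mathsf{LPO}$: for every $p \in 2^{\mathbb{N}}$, either $p = 0^\omega$ or there exists $n$ with $p_n = 1$. For injections $f, g : X \to X$ and $m \in \mathbb{Z}$, let $R^{f,g}_m \subseteq X \times X$ be the partial injection $f \circ (g \circ f)^m$: for $m \ge 0$, $(x,y) \in R^{f,g}_m$ iff $y = f((g\circ f)^m(x))$; for $m < 0$, $(x,y) \in R^{f,g}_m$ iff $x = g((f \circ g)^{ -m-1}(y))$. A set $X$ has the $\neg\neg$ strong Myhill property if for every pair of injections $f, g : X \to X$ there is a bijection $h : X \to X$ such that for every $x \in X$, $\neg\neg\, \exists m \in \mathbb{Z}.\ (x,h(x)) \in R^{f,g}_m$. -}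

module Defs where

open import Data.Bool.Base using (Bool; true; false)
open import Data.Integer.Base using (ℤ; +_; -[1+_])
open import Data.Nat.Base using (ℕ)
open import Data.Nat.GeneralisedArithmetic using (fold)
open import Data.Product.Base using (Σ-syntax; ∃-syntax; proj₁)
open import Data.Sum.Base using (_⊎_)
open import Data.Sum.Relation.Binary.Pointwise using (_⊎ₛ_)
open import Function.Base using (_∘_; const)
open import Function.Bundles using (Injection; Bijection)
open import Level using (Level; _⊔_; 0ℓ)
open import Relation.Binary.Bundles using (Setoid)
open import Relation.Binary.Core using (Rel)
import Relation.Binary.Construct.On as On
open import Relation.Binary.PropositionalEquality
  using (_≡_; _≗_; setoid; _→-setoid_)
open import Relation.Nullary.Negation.Core using (¬_)

private variable
  c ℓ : Level

-- Sets are rendered as setoids, and their functions as functions respecting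
-- the setoid equality; in particular 2^ℕ carries pointwise equality.

2^ℕ : Set
2^ℕ = ℕ → Bool

0^ω : 2^ℕ
0^ω = const false

MarkovPrinciple : Set
MarkovPrinciple = (p : 2^ℕ) → ¬ (p ≗ 0^ω) → ∃[ n ] p n ≡ true

LPO : Set
LPO = (p : 2^ℕ) → p ≗ 0^ω ⊎ (∃[ n ] p n ≡ true)

AtMostOne1 : 2^ℕ → Set
AtMostOne1 p = ∀ m n → p m ≡ true → p n ≡ true → m ≡ n

-- As a subset of 2^ℕ: equality ignores the proof component.
ℕ∞ : Setoid 0ℓ 0ℓ
ℕ∞ = On.setoid {B = Σ[ p ∈ 2^ℕ ] AtMostOne1 p} (ℕ →-setoid Bool) proj₁

ℕ+ℕ∞ : Setoid 0ℓ 0ℓ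
ℕ+ℕ∞ = setoid ℕ ⊎ₛ ℕ∞

module _ (X : Setoid c ℓ) where
  open Setoid X

  -- R f g m is the graph of the partial injection f ∘ (g ∘ f)ᵐ.
  -- Since -[1+ n ] is m = -(n + 1), the exponent -m-1 is n.
  R : (f g : Carrier → Carrier) → ℤ → Rel Carrier ℓ
  R f g (+ m)    x y = y ≈ f (fold x (g ∘ f) m)
  R f g -[1+ n ] x y = x ≈ g (fold y (f ∘ g) n)

  ¬¬StrongMyhill : Set (c ⊔ ℓ)
  ¬¬StrongMyhill =
    (f g : Injection X X) →
    Σ[ h ∈ Bijection X X ]
      (∀ x → ¬ ¬ (∃[ m ] R (Injection.to f) (Injection.to g) m x (Bijection.to h x)))

{-# OPTIONS --safe #-}
-- Under LPO, existence is decidable over ℕ + ℕ∞, so the Cantor–Schröder–Bernstein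
-- construction goes through: h x is f x if x lies in the forward g ∘ f orbit of
-- a point outside the range of g, and g⁻¹ x otherwise.
--
-- Conversely, let f and g fix the point ∞ = inr 0^ω, and let every y = inl (2n) start
-- a chain y, g y, f (g y), … all of whose later points lie in ℕ∞ and have no 1 before n.
-- A bijection h along the chains then has h⁻¹ (inl (2n)) = inr qₙ with qₙ → ∞, although
-- h (inr ∞) is not in ℕ. If p has at most one 1, the sequence p′ that is
-- qₙ if p n = 1, and 0^ω if p = 0^ω, can be defined without knowing which;
-- the summand containing h (inr p′) decides whether p = 0^ω.
module Submission where

open import Defs
open import Data.Bool.Base using (true; false)
open import Data.Bool.Properties using (¬-not) renaming (_≟_ to _≟ᵇ_)
open import Data.Integer.Base using (+_; -[1+_])
open import Data.Nat.Base using (ℕ; zero; suc; _+_; _≤_; _<_; s≤s)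
open import Data.Nat.GeneralisedArithmetic using (fold)
open import Data.Nat.Induction using (<-rec)
open import Data.Nat.Properties
  using (_≟_; _≤?_; +-suc; <-cmp; ≤-trans; m≤m+n; m≤n⇒m≤1+n; anyUpTo?)
open import Data.Product.Base using (∃; ∃-syntax; _×_; _,_; proj₁; proj₂)
open import Data.Sum.Base as Sum using (_⊎_; inj₁; inj₂; [_,_]′)
open import Data.Sum.Relation.Binary.Pointwise using (_⊎ₛ_; inj₁; inj₂; ⊎-decidable)
open import Function.Base using (_∘_)
open import Function.Bundles using (_⇔_; mk⇔; Injection; Bijection)
open import Function.Definitions using (Congruent)
open import Level using (Level; 0ℓ)
open import Relation.Binary.Bundles using (Setoid)
open import Relation.Binary.Definitions using (_Respects_; tri<; tri≈; tri>)
open import Relation.Binary.PropositionalEquality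
  using (_≡_; _≗_; refl; sym; trans; cong; subst; setoid)
open import Relation.Nullary.Decidable
  using (Dec; yes; no; does; dec-true; dec-false; map′; ¬?; _×-dec_; _⊎-dec_;
         decidable-stable)
open import Relation.Nullary.Negation.Core using (¬_; contradiction)
open import Relation.Unary using (Pred; Decidable)

private variable
  a p : Level

does⇒ : {A : Set a} (A? : Dec A) → does A? ≡ true → A
does⇒ (yes x) _ = x

false≢true : ∀ {b} → b ≡ false → ¬ (b ≡ true)
false≢true refl ()

fold-pres : {A : Set a} (P : Pred A p) {s : A → A} → (∀ {x} → P x → P (s x)) →
            ∀ {z} → P z → ∀ n → P (fold z s n)
fold-pres P step Pz zero    = Pz
fold-pres P step Pz (suc n) = step (fold-pres P step Pz n)

-- Omniscient sets

Omniscient : Setoid 0ℓ 0ℓ → Set₁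
Omniscient X = {P : Pred Carrier 0ℓ} → P Respects _≈_ → Decidable P → Dec (∃ P)
  where open Setoid X

DecidableEquality : Setoid 0ℓ 0ℓ → Set
DecidableEquality X = ∀ x y → Dec (x ≈ y)
  where open Setoid X

module _ (lpo : LPO) where

  ℕ-omniscient : {P : Pred ℕ 0ℓ} → Decidable P → Dec (∃ P)
  ℕ-omniscient P? with lpo (does ∘ P?)
  ... | inj₁ none    = no λ (n , Pn) → false≢true (none n) (dec-true (P? n) Pn)
  ... | inj₂ (n , q) = yes (n , does⇒ (P? n) q)

δ : ℕ → Setoid.Carrier ℕ∞
δ k = does ∘ (k ≟_) , λ m n km kn → trans (sym (does⇒ (k ≟ m) km)) (does⇒ (k ≟ n) kn)

∞ : Setoid.Carrier ℕ∞
∞ = 0^ω , λ _ _ ()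

δ-self : ∀ k → proj₁ (δ k) k ≡ true
δ-self k = dec-true (k ≟ k) refl

≗-bits : {p q : 2^ℕ} → (∀ k → p k ≡ true → q k ≡ true) → (∀ k → q k ≡ true → p k ≡ true) →
         p ≗ q
≗-bits {p} {q} p⇒q q⇒p k with p k in pk | q k in qk
... | true  | true  = refl
... | false | false = refl
... | true  | false = contradiction (p⇒q k pk) (false≢true qk)
... | false | true  = contradiction (q⇒p k qk) (false≢true pk)

≗-δ : ((p , p≤1) : Setoid.Carrier ℕ∞) → ∀ {n} → p n ≡ true → p ≗ proj₁ (δ n)
≗-δ (p , p≤1) {n} pn =
  ≗-bits (λ k pk → dec-true (n ≟ k) (p≤1 n k pn pk))
         (λ k nk → subst (λ m → p m ≡ true) (does⇒ (n ≟ k) nk) pn)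

module _ (lpo : LPO) where

  -- By `lpo` every point is `∞` or some `δ n`, so one test at `∞` and a search over ℕ cover the
  -- whole set.
  ℕ∞-omniscient : Omniscient ℕ∞
  ℕ∞-omniscient {P} resp P? =
    map′ [ (∞ ,_) , (λ (n , Pn) → δ n , Pn) ]′ from
      (P? ∞ ⊎-dec ℕ-omniscient lpo (P? ∘ δ))
    where
    from : ∃ P → P ∞ ⊎ ∃ (P ∘ δ)
    from (x , Px) with lpo (proj₁ x)
    ... | inj₁ x≗0      = inj₁ (resp x≗0 Px)
    ... | inj₂ (n , xn) = inj₂ (n , resp (≗-δ x xn) Px)

  ℕ∞-decEq : DecidableEquality ℕ∞
  ℕ∞-decEq (p , _) (q , _) with ℕ-omniscient lpo (λ n → ¬? (p n ≟ᵇ q n))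
  ... | yes (n , p≢q) = no λ p≗q → p≢q (p≗q n)
  ... | no none       = yes λ n → decidable-stable (p n ≟ᵇ q n) (λ p≢q → none (n , p≢q))

module _ {X Y : Setoid 0ℓ 0ℓ} where

  ⊎-omniscient : Omniscient X → Omniscient Y → Omniscient (X ⊎ₛ Y)
  ⊎-omniscient searchX searchY resp P? =
    map′ [ (λ (x , Px) → inj₁ x , Px) , (λ (y , Py) → inj₂ y , Py) ]′
         (λ { (inj₁ x , Px) → inj₁ (x , Px) ; (inj₂ y , Py) → inj₂ (y , Py) })
         (searchX (resp ∘ inj₁) (P? ∘ inj₁) ⊎-dec searchY (resp ∘ inj₂) (P? ∘ inj₂))

-- Cantor–Schröder–Bernstein

module CSB (lpo : LPO) (X : Setoid 0ℓ 0ℓ) (search : Omniscient X) (_≈?_ : DecidableEquality X)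
           (F G : Injection X X) where
  open Setoid X renaming (refl to ≈-refl; sym to ≈-sym; trans to ≈-trans)
  open Injection F using () renaming (to to f; cong to f-cong; injective to f-inj)
  open Injection G using () renaming (to to g; cong to g-cong; injective to g-inj)

  Range : Pred Carrier 0ℓ
  Range x = ∃[ y ] x ≈ g y

  Range-resp : Range Respects _≈_
  Range-resp x≈x′ (y , x≈gy) = y , ≈-trans (≈-sym x≈x′) x≈gy

  Range? : Decidable Range
  Range? x = search (λ y≈y′ x≈gy → ≈-trans x≈gy (g-cong y≈y′)) (λ y → x ≈? g y)

  Orbit : Pred Carrier 0ℓ
  Orbit x = ∃[ n ] ∃[ z ] (¬ Range z) × x ≈ fold z (g ∘ f) n

  Orbit-resp : Orbit Respects _≈_
  Orbit-resp x≈x′ (n , z , z∉ , x≈) = n , z , z∉ , ≈-trans (≈-sym x≈x′) x≈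

  fold-cong : ∀ {z z′} → z ≈ z′ → ∀ n → fold z (g ∘ f) n ≈ fold z′ (g ∘ f) n
  fold-cong z≈z′ zero    = z≈z′
  fold-cong z≈z′ (suc n) = g-cong (f-cong (fold-cong z≈z′ n))

  Orbit? : Decidable Orbit
  Orbit? x = ℕ-omniscient lpo λ n →
    search (λ z≈z′ (z∉ , x≈) → (z∉ ∘ Range-resp (≈-sym z≈z′)) , ≈-trans x≈ (fold-cong z≈z′ n))
           (λ z → ¬? (Range? z) ×-dec (x ≈? fold z (g ∘ f) n))

  Orbit-gf : ∀ {x} → Orbit x → Orbit (g (f x))
  Orbit-gf (n , z , z∉ , x≈) = suc n , z , z∉ , g-cong (f-cong x≈)

  -- A point `g y` cannot start an orbit, so it is reached by a last step `g ∘ f`; cancelling `g`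
  -- exposes the preimage under `f`.
  Orbit-g⁻¹ : ∀ {y} → Orbit (g y) → ∃[ x ] Orbit x × y ≈ f x
  Orbit-g⁻¹ (zero  , z , z∉ , gy≈z) = contradiction (_ , ≈-sym gy≈z) z∉
  Orbit-g⁻¹ (suc n , z , z∉ , gy≈)  = fold z (g ∘ f) n , (n , z , z∉ , ≈-refl) , g-inj gy≈

  ¬Orbit⇒Range : ∀ {x} → ¬ Orbit x → Range x
  ¬Orbit⇒Range x∉ = decidable-stable (Range? _) λ x∉g → x∉ (0 , _ , x∉g , ≈-refl)

  -- The graph of the bijection. As a relation it can be proved functional and injective by cases,
  -- without unfolding the decision made in `match`.
  data Match (x y : Carrier) : Set where
    via-f   : Orbit x     → y ≈ f x → Match x y
    via-g⁻¹ : (¬ Orbit x) → x ≈ g y → Match x y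

  match : ∀ x → ∃ (Match x)
  match x with Orbit? x
  ... | yes x∈ = f x , via-f x∈ ≈-refl
  ... | no  x∉ = proj₁ (¬Orbit⇒Range x∉) , via-g⁻¹ x∉ (proj₂ (¬Orbit⇒Range x∉))

  match⁻¹ : ∀ y → ∃[ x ] Match x y
  match⁻¹ y with Orbit? (g y)
  ... | no  gy∉ = g y , via-g⁻¹ gy∉ ≈-refl
  ... | yes gy∈ with Orbit-g⁻¹ gy∈
  ...   | x , x∈ , y≈fx = x , via-f x∈ y≈fx

  Match-functional : ∀ {x x′ y y′} → x ≈ x′ → Match x y → Match x′ y′ → y ≈ y′
  Match-functional x≈ (via-f _ y≈)    (via-f _ y′≈)    = ≈-trans y≈ (≈-trans (f-cong x≈) (≈-sym y′≈))
  Match-functional x≈ (via-f x∈ _)    (via-g⁻¹ x′∉ _)  = contradiction (Orbit-resp x≈ x∈) x′∉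
  Match-functional x≈ (via-g⁻¹ x∉ _)  (via-f x′∈ _)    = contradiction (Orbit-resp (≈-sym x≈) x′∈) x∉
  Match-functional x≈ (via-g⁻¹ _ x≈g) (via-g⁻¹ _ x′≈g) = g-inj (≈-trans (≈-sym x≈g) (≈-trans x≈ x′≈g))

  -- Rules out the mixed cases of injectivity: here `x′ ≈ g (f x)`, one step further along the orbit
  -- of `x`.
  Orbit-match : ∀ {x x′ y y′} → y ≈ y′ → Orbit x → y ≈ f x → x′ ≈ g y′ → Orbit x′
  Orbit-match y≈ x∈ y≈f x′≈g =
    Orbit-resp (≈-trans (g-cong (≈-trans (≈-sym y≈f) y≈)) (≈-sym x′≈g)) (Orbit-gf x∈)

  Match-injective : ∀ {x x′ y y′} → y ≈ y′ → Match x y → Match x′ y′ → x ≈ x′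
  Match-injective y≈ (via-f _ y≈f)   (via-f _ y′≈f)   = f-inj (≈-trans (≈-sym y≈f) (≈-trans y≈ y′≈f))
  Match-injective y≈ (via-f x∈ y≈f)  (via-g⁻¹ x′∉ x′≈g) =
    contradiction (Orbit-match y≈ x∈ y≈f x′≈g) x′∉
  Match-injective y≈ (via-g⁻¹ x∉ x≈g) (via-f x′∈ y′≈f) =
    contradiction (Orbit-match (≈-sym y≈) x′∈ y′≈f x≈g) x∉
  Match-injective y≈ (via-g⁻¹ _ x≈g) (via-g⁻¹ _ x′≈g) = ≈-trans x≈g (≈-trans (g-cong y≈) (≈-sym x′≈g))

  h : Bijection X X
  h = record
    { to        = proj₁ ∘ match
    ; cong      = λ {x} {x′} x≈x′ → Match-functional x≈x′ (proj₂ (match x)) (proj₂ (match x′))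
    ; bijective =
        (λ {x} {x′} hx≈hx′ → Match-injective hx≈hx′ (proj₂ (match x)) (proj₂ (match x′)))
      , λ y → proj₁ (match⁻¹ y) ,
              λ {z} z≈x → Match-functional z≈x (proj₂ (match z)) (proj₂ (match⁻¹ y))
    }

  -- The exponents 0 and -1 suffice: `f` itself and the inverse of `g`.
  Match⇒R : ∀ {x y} → Match x y → ∃[ m ] R X f g m x y
  Match⇒R (via-f _ y≈fx)   = + 0 , y≈fx
  Match⇒R (via-g⁻¹ _ x≈gy) = -[1+ 0 ] , x≈gy

LPO⇒¬¬StrongMyhill : LPO → ¬¬StrongMyhill ℕ+ℕ∞
LPO⇒¬¬StrongMyhill lpo f g = h , λ x ¬chain → ¬chain (Match⇒R (proj₂ (match x)))
  where
  _≈?_ : DecidableEquality ℕ+ℕ∞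
  _≈?_ = ⊎-decidable _≟_ (ℕ∞-decEq lpo)

  search : Omniscient ℕ+ℕ∞
  search = ⊎-omniscient {setoid ℕ} {ℕ∞} (λ _ → ℕ-omniscient lpo) (ℕ∞-omniscient lpo)

  open CSB lpo ℕ+ℕ∞ search _≈?_ f g

-- ¬¬ strong Myhill bijections and omniscience

open Setoid ℕ+ℕ∞ using (Carrier; _≈_) renaming (sym to ≈-sym; trans to ≈-trans)

-- Parity

even odd : ℕ → ℕ
even n = n + n
odd  n = suc (n + n)

-- The bijection of ℕ with ℕ + ℕ: even numbers 2n go to `inj₁ n`, odd numbers 2n + 1 to `inj₂ n`.
halve : ℕ → ℕ ⊎ ℕ
halve 0             = inj₁ 0
halve 1             = inj₂ 0
halve (suc (suc n)) = Sum.map suc suc (halve n)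

halve-even : ∀ n → halve (even n) ≡ inj₁ n
halve-even zero = refl
halve-even (suc n) rewrite +-suc n n | halve-even n = refl

halve-odd : ∀ n → halve (odd n) ≡ inj₂ n
halve-odd zero = refl
halve-odd (suc n) rewrite +-suc n n | halve-odd n = refl

unhalve : ℕ ⊎ ℕ → ℕ
unhalve = [ even , odd ]′

unhalve-suc : ∀ s → unhalve (Sum.map suc suc s) ≡ suc (suc (unhalve s))
unhalve-suc (inj₁ n) = cong suc (+-suc n n)
unhalve-suc (inj₂ n) = cong (suc ∘ suc) (+-suc n n)

unhalve-halve : ∀ n → unhalve (halve n) ≡ n
unhalve-halve 0             = refl
unhalve-halve 1             = refl
unhalve-halve (suc (suc n)) = trans (unhalve-suc (halve n)) (cong (suc ∘ suc) (unhalve-halve n))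

halve-injective : ∀ {m n s} → halve m ≡ s → halve n ≡ s → m ≡ n
halve-injective {m} {n} refl eq =
  trans (sym (unhalve-halve m)) (trans (cong unhalve (sym eq)) (unhalve-halve n))

-- Moves bit j to position 2j + 1. The all-0 sequence stays fixed, and the points `δ (even n)` are
-- left free as values of `g` on ℕ.
spread : 2^ℕ → 2^ℕ
spread p k = [ 0^ω , p ]′ (halve k)

spread-odd : ∀ p j → spread p (odd j) ≡ p j
spread-odd p j = cong [ 0^ω , p ]′ (halve-odd j)

spread-even : ∀ p j → spread p (even j) ≡ false
spread-even p j = cong [ 0^ω , p ]′ (halve-even j)

spread-true : ∀ p k → spread p k ≡ true → ∃[ j ] halve k ≡ inj₂ j × p j ≡ true
spread-true p k eq with halve k
... | inj₂ j = j , refl , eq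

spread-cong : ∀ {p q} → p ≗ q → spread p ≗ spread q
spread-cong p≗q k with halve k
... | inj₁ _ = refl
... | inj₂ j = p≗q j

spread∞ : Setoid.Carrier ℕ∞ → Setoid.Carrier ℕ∞
spread∞ (p , p≤1) = spread p , atMostOne
  where
  atMostOne : AtMostOne1 (spread p)
  atMostOne m n sm sn with spread-true p m sm | spread-true p n sn
  ... | i , hm , pi | j , hn , pj with refl ← p≤1 i j pi pj = halve-injective {m} {n} hm hn

-- Two injections whose chains lead from even numbers into ℕ∞

f : Carrier → Carrier
f (inj₁ n) = inj₁ (odd n)
f (inj₂ p) = inj₂ p

-- Odd numbers return along `f`; even numbers, which `f` misses, enter ℕ∞ at a position that grows
-- with n.
g-halved : ℕ ⊎ ℕ → Carrier
g-halved (inj₁ n) = inj₂ (δ (even n))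
g-halved (inj₂ n) = inj₁ n

g : Carrier → Carrier
g (inj₁ k) = g-halved (halve k)
g (inj₂ p) = inj₂ (spread∞ p)

F : Injection ℕ+ℕ∞ ℕ+ℕ∞
F = record { to = f ; cong = f-cong ; injective = λ {x} {y} → f-injective x y }
  where
  f-cong : Congruent _≈_ _≈_ f
  f-cong (inj₁ refl) = inj₁ refl
  f-cong (inj₂ p≗q)  = inj₂ p≗q

  f-injective : ∀ x y → f x ≈ f y → x ≈ y
  f-injective (inj₁ m) (inj₁ n) (inj₁ eq)
    with refl ← trans (sym (halve-odd m)) (trans (cong halve eq) (halve-odd n)) = inj₁ refl
  f-injective (inj₂ _) (inj₂ _) (inj₂ p≗q) = inj₂ p≗q

δ-injective : ∀ {m n} → proj₁ (δ m) ≗ proj₁ (δ n) → m ≡ n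
δ-injective {m} {n} eq = does⇒ (m ≟ n) (trans (eq n) (δ-self n))

δ-even≢spread : ∀ n p → ¬ (proj₁ (δ (even n)) ≗ spread p)
δ-even≢spread n p eq = false≢true (spread-even p n) (trans (sym (eq (even n))) (δ-self (even n)))

G : Injection ℕ+ℕ∞ ℕ+ℕ∞
G = record { to = g ; cong = g-cong ; injective = λ {x} {y} → g-injective x y }
  where
  g-cong : Congruent _≈_ _≈_ g
  g-cong (inj₁ refl) = Setoid.refl ℕ+ℕ∞
  g-cong (inj₂ p≗q)  = inj₂ (spread-cong p≗q)

  g-injective : ∀ x y → g x ≈ g y → x ≈ y
  g-injective (inj₁ k) (inj₁ l) eq with halve k in hk | halve l in hl
  g-injective (inj₁ k) (inj₁ l) (inj₂ eq) | inj₁ m | inj₁ n =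
    inj₁ (trans (sym (unhalve-halve k)) (trans (cong unhalve hk)
      (trans (δ-injective {even m} {even n} eq) (trans (cong unhalve (sym hl)) (unhalve-halve l)))))
  g-injective (inj₁ k) (inj₁ l) (inj₁ refl) | inj₂ m | inj₂ m = inj₁ (halve-injective {k} {l} hk hl)
  g-injective (inj₁ k) (inj₂ (p , _)) eq with halve k
  g-injective (inj₁ k) (inj₂ (p , _)) (inj₂ eq) | inj₁ m = contradiction eq (δ-even≢spread m p)
  g-injective (inj₂ (p , _)) (inj₁ k) eq with halve k
  g-injective (inj₂ (p , _)) (inj₁ k) (inj₂ eq) | inj₁ m =
    contradiction (sym ∘ eq) (δ-even≢spread m p)
  g-injective (inj₂ (p , _)) (inj₂ (q , _)) (inj₂ eq) =
    inj₂ λ j → trans (sym (spread-odd p j)) (trans (eq (odd j)) (spread-odd q j))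

-- Invariants along the chains

-- Being away from `inj₂ ∞`, in positive form: both injections carry the witnessing position along.
data Isolated : Pred Carrier 0ℓ where
  inl : ∀ {n} → Isolated (inj₁ n)
  inr : ∀ {p k} → proj₁ p k ≡ true → Isolated (inj₂ p)

Isolated-resp : Isolated Respects _≈_
Isolated-resp (inj₁ _)  inl              = inl
Isolated-resp (inj₂ eq) (inr {k = k} pk) = inr (trans (sym (eq k)) pk)

∞-notIsolated : ¬ Isolated (inj₂ ∞)
∞-notIsolated (inr ())

Isolated-f : ∀ {x} → Isolated x → Isolated (f x)
Isolated-f inl      = inl
Isolated-f (inr pk) = inr pk

Isolated-g : ∀ {x} → Isolated x → Isolated (g x)
Isolated-g {inj₁ k} inl with halve k
... | inj₁ n = inr (δ-self (even n))
... | inj₂ _ = inl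
Isolated-g {inj₂ (p , _)} (inr {k = k} pk) = inr {k = odd k} (trans (spread-odd p k) pk)

data InRight : Pred Carrier 0ℓ where
  inr : ∀ {p} → InRight (inj₂ p)

InRight-gf : ∀ {x} → InRight x → InRight (g (f x))
InRight-gf inr = inr

-- Forward from `∞`, the chain stays in the right summand. Backward, `∞` would be the image of
-- `inj₁ k` under maps that preserve `Isolated`.
R-∞ : ∀ m k → ¬ R ℕ+ℕ∞ f g m (inj₂ ∞) (inj₁ k)
R-∞ (+ m) k eq with fold (inj₂ ∞) (g ∘ f) m | fold-pres InRight InRight-gf {inj₂ ∞} inr m
R-∞ (+ m) k () | .(inj₂ _) | inr
R-∞ -[1+ n ] k eq =
  ∞-notIsolated (Isolated-resp (≈-sym eq)
    (Isolated-g (fold-pres Isolated (Isolated-f ∘ Isolated-g) {inj₁ k} inl n)))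

-- A neighbourhood of `∞`. No 1 is asserted to exist, which keeps the predicate stable under double
-- negation.
data Beyond (n : ℕ) : Pred Carrier 0ℓ where
  beyond : ∀ {q} → (∀ k → proj₁ q k ≡ true → n ≤ k) → Beyond n (inj₂ q)

Beyond-resp : ∀ {n} → Beyond n Respects _≈_
Beyond-resp (inj₂ eq) (beyond b) = beyond λ k qk → b k (trans (eq k) qk)

n≤odd : ∀ n → n ≤ odd n
n≤odd n = m≤n⇒m≤1+n (m≤m+n n n)

Beyond-gf : ∀ {n x} → Beyond n x → Beyond n (g (f x))
Beyond-gf {n} (beyond {q , _} b) = beyond bound
  where
  bound : ∀ k → spread q k ≡ true → n ≤ k
  bound k sk with spread-true q k sk
  ... | j , hk , qj with refl ← halve-injective {k} {odd j} hk (halve-odd j) = ≤-trans (b j qj) (n≤odd j)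

Beyond-g-even : ∀ n → Beyond n (g (inj₁ (even n)))
Beyond-g-even n rewrite halve-even n =
  beyond λ k nk → subst (n ≤_) (does⇒ (even n ≟ k) nk) (m≤m+n n n)

Beyond-chain : ∀ n j → Beyond n (g (fold (inj₁ (even n)) (f ∘ g) j))
Beyond-chain n zero    = Beyond-g-even n
-- Reassociation: `g` after a further `f ∘ g` is `g ∘ f` applied to the previous point.
Beyond-chain n (suc j) = Beyond-gf (Beyond-chain n j)

-- For m ≥ 0 the endpoint is a value of `f`, hence odd or in ℕ∞; only the backward chains from
-- `inj₁ (even n)` remain.
R-even : ∀ m {x n} → R ℕ+ℕ∞ f g m x (inj₁ (even n)) → Beyond n x
R-even (+ m) {x} {n} eq with fold x (g ∘ f) m
R-even (+ m) {x} {n} (inj₁ eq) | inj₁ k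
  with () ← trans (sym (halve-even n)) (trans (cong halve eq) (halve-odd k))
R-even -[1+ j ] {x} {n} eq = Beyond-resp (≈-sym eq) (Beyond-chain n j)

-- Both the summand of `x` and each inequality `n ≤ k` are decidable. This extracts usable bounds
-- from the doubly negated chain condition.
Beyond-stable : ∀ n x → ¬ ¬ Beyond n x → Beyond n x
Beyond-stable n (inj₁ k) ¬¬b = contradiction (λ ()) ¬¬b
Beyond-stable n (inj₂ q) ¬¬b = beyond λ k qk →
  decidable-stable (n ≤? k) λ n≰k → ¬¬b λ { (beyond b) → n≰k (b k qk) }

-- Deciding whether a sequence with at most one 1 vanishes

module Decide (h : Bijection ℕ+ℕ∞ ℕ+ℕ∞)
              (chain : ∀ x → ¬ ¬ (∃[ m ] R ℕ+ℕ∞ f g m x (Bijection.to h x))) where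
  open Bijection h using (to; strictlySurjective; injective) renaming (cong to to-cong)

  to-∞ : ∀ {k} → ¬ (to (inj₂ ∞) ≈ inj₁ k)
  to-∞ {k} eq with to (inj₂ ∞) | chain (inj₂ ∞)
  to-∞ {k} (inj₁ refl) | _ | ¬¬R = ¬¬R λ (m , Rm) → R-∞ m k Rm

  to-even : ∀ n x → to x ≈ inj₁ (even n) → Beyond n x
  to-even n x eq with to x | eq | chain x
  ... | _ | inj₁ refl | ¬¬R = Beyond-stable n x λ ¬b → ¬¬R λ (m , Rm) → ¬b (R-even m Rm)

  -- Surjectivity yields points of ℕ∞ that converge to `∞` while their images stay in ℕ.
  preimage : ∀ n → ∃[ q ] to (inj₂ q) ≈ inj₁ (even n) × Beyond n (inj₂ q)
  preimage n with strictlySurjective (inj₁ (even n))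
  ... | x , eq with to-even n x eq
  ...   | b@(beyond {q} _) = q , eq , b

  q : ℕ → Setoid.Carrier ℕ∞
  q n = proj₁ (preimage n)

  q-beyond : ∀ n k → proj₁ (q n) k ≡ true → n ≤ k
  q-beyond n with preimage n
  ... | _ , _ , beyond b = b

  module _ (p : 2^ℕ) (p≤1 : AtMostOne1 p) where

    Hit : ℕ → ℕ → Set
    Hit k n = p n ≡ true × proj₁ (q n) k ≡ true

    -- n ≤ k suffices in the search, as q n has no 1 before n.
    hit? : ∀ k → Dec (∃[ n ] n < suc k × Hit k n)
    hit? k = anyUpTo? (λ n → (p n ≟ᵇ true) ×-dec (proj₁ (q n) k ≟ᵇ true)) (suc k)

    p′ : Setoid.Carrier ℕ∞
    p′ = does ∘ hit? , atMostOne
      where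
      atMostOne : AtMostOne1 (does ∘ hit?)
      atMostOne k l k∈ l∈ with does⇒ (hit? k) k∈ | does⇒ (hit? l) l∈
      -- Both hits select the same index because `p` has at most one 1, so both positions are 1s of
      -- the single point `q m`.
      ... | m , _ , pm , qm | n , _ , pn , qn with refl ← p≤1 m n pm pn = proj₂ (q m) k l qm qn

    p′-zero : p ≗ 0^ω → proj₁ p′ ≗ 0^ω
    p′-zero p≗0 k = dec-false (hit? k) λ (n , _ , pn , _) → false≢true (p≗0 n) pn

    p′-one : ∀ {n} → p n ≡ true → proj₁ p′ ≗ proj₁ (q n)
    p′-one {n} pn = ≗-bits to-q from-q
      where
      to-q : ∀ k → proj₁ p′ k ≡ true → proj₁ (q n) k ≡ true
      to-q k k∈ with does⇒ (hit? k) k∈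
      ... | m , _ , pm , qm with refl ← p≤1 m n pm pn = qm

      from-q : ∀ k → proj₁ (q n) k ≡ true → proj₁ p′ k ≡ true
      from-q k qk = dec-true (hit? k) (n , s≤s (q-beyond n k qk) , pn , qk)

    -- If `p` vanishes, `p′` is `∞`, whose image is not in ℕ. If `p n` is 1, `p′` is `q n`, whose
    -- image is `inj₁ (even n)`. The summand of the image thus refutes one of the two.
    decide : Dec (p ≗ 0^ω)
    decide with to (inj₂ p′) in eq
    ... | inj₁ k = no λ p≗0 → to-∞ {k}
      (subst (to (inj₂ ∞) ≈_) eq (to-cong (inj₂ (sym ∘ p′-zero p≗0))))
    ... | inj₂ _ = yes λ n → ¬-not λ pn → case-inr
      (subst (_≈ inj₁ (even n)) eq
        (≈-trans (to-cong (inj₂ (p′-one pn))) (proj₁ (proj₂ (preimage n)))))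
      where
      case-inr : ∀ {y n} → ¬ (inj₂ y ≈ inj₁ n)
      case-inr ()

-- Reduction to sequences with at most one 1

module FirstOne (p : 2^ℕ) where

  earlier? : ∀ n → Dec (∃[ m ] m < n × p m ≡ true)
  earlier? = anyUpTo? (λ m → p m ≟ᵇ true)

  firstOne? : ∀ n → Dec (p n ≡ true × ¬ (∃[ m ] m < n × p m ≡ true))
  firstOne? n = (p n ≟ᵇ true) ×-dec ¬? (earlier? n)

  first : Setoid.Carrier ℕ∞
  first = does ∘ firstOne? , atMostOne
    where
    atMostOne : AtMostOne1 (does ∘ firstOne?)
    atMostOne m n m∈ n∈ with does⇒ (firstOne? m) m∈ | does⇒ (firstOne? n) n∈ | <-cmp m n
    ... | pm , _ | _ , ¬<n | tri< m<n _ _ = contradiction (m , m<n , pm) ¬<n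
    ... | _      | _       | tri≈ _ m≡n _ = m≡n
    ... | _ , ¬<m | pn , _ | tri> _ _ n<m = contradiction (n , n<m , pn) ¬<m

  -- By strong induction: with no earlier 1, a 1 at `n` would be the first one and so survive in
  -- `first`.
  first-zero : proj₁ first ≗ 0^ω → p ≗ 0^ω
  first-zero first≗0 = <-rec _ λ n earlier → ¬-not λ pn →
    false≢true (first≗0 n)
      (dec-true (firstOne? n) (pn , λ (m , m<n , pm) → false≢true (earlier m<n) pm))

¬¬StrongMyhill⇒LPO : MarkovPrinciple → ¬¬StrongMyhill ℕ+ℕ∞ → LPO
¬¬StrongMyhill⇒LPO mp myhill p = from (decide (proj₁ first) (proj₂ first))
  where
  open Decide (proj₁ (myhill F G)) (proj₂ (myhill F G)) using (decide)
  open FirstOne p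

  from : Dec (proj₁ first ≗ 0^ω) → p ≗ 0^ω ⊎ (∃[ n ] p n ≡ true)
  from (yes first≗0) = inj₁ (first-zero first≗0)
  from (no  first≢0) with mp (proj₁ first) first≢0
  ... | n , n∈ = inj₂ (n , proj₁ (does⇒ (firstOne? n) n∈))

theorem48 : MarkovPrinciple → LPO ⇔ ¬¬StrongMyhill ℕ+ℕ∞
theorem48 mp = mk⇔ LPO⇒¬¬StrongMyhill (¬¬StrongMyhill⇒LPO mp)
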